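{- For any CCS processes $p$ and $q$: $p\approx q$ if and only if ($p\approx^c q$ or $p\approx^c \tau.q$ or $\tau.p\approx^c q$).
   Context: Processes. Let $\alpha$ and $\beta$ be nonempty sets. Labels are $\mathrm{name}(b)$ and $\mathrm{coname}(b)$ for $b\in\beta$; the complement $\overline{\cdot}$ exchanges $\mathrm{name}(b)$ and $\mathrm{coname}(b)$. Actions are $\tau$ and the labels. CCS processes are the terms freely generated by: $\mathrm{nil}$; variables (constants) $X\in\alpha$; $u.E$ ($u$ an action); $E+E'$; $E\,||\,E'$; $\nu L\,E$ ($L$ a set of labels); $\mathrm{relab}(E,f)$ ($f$ a function from labels to labels commuting with complement, extended to actions by $f(\tau)=\tau$); $\mathrm{rec}\,X.E$. The transition relation $E\xrightarrow{u}E'$ is the least relation such that: $u.E\xrightarrow{u}E$; if $E\xrightarrow{u}E_1$ then $E+E'\xrightarrow{u}E_1$ and $E'+E\xrightarrow{u}E_1$; if $E\xrightarrow{u}E_1$ then $E||E'\xrightarrow{u}E_1||E'$ and $E'||E\xrightarrow{u}E'||E_1$; if $E\xrightarrow{l}E_1$ and $E'\xrightarrow{\overline{l}}E_2$ for a label $l$ then $E||E'\xrightarrow{\tau}E_1||E_2$; if $E\xrightarrow{u}E_1$ and either $u=\tau$ or $u$ is a label with $u,\overline{u}\notin L$, then $\nu L\,E\xrightarrow{u}\nu L\,E_1$; if $E\xrightarrow{u}E_1$ then $\mathrm{relab}(E,f)\xrightarrow{f(u)}\mathrm{relab}(E_1,f)$; if $E\{\mathrm{rec}\,X.E/X\}\xrightarrow{u}E_1$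 then $\mathrm{rec}\,X.E\xrightarrow{u}E_1$ (the substitution replaces the occurrences of $X$ not under a binder $\mathrm{rec}\,X$). Weak notions. $E\overset{\epsilon}{\Rightarrow}E'$ is the reflexive transitive closure of $\xrightarrow{\tau}$. For any action $u$ (including $\tau$), $E\overset{u}{\Rightarrow}E'$ means there are $E_1,E_2$ with $E\overset{\epsilon}{\Rightarrow}E_1\xrightarrow{u}E_2\overset{\epsilon}{\Rightarrow}E'$. A relation $W$ on processes is a weak bisimulation if whenever $W\,E\,E'$: for each label $l$, $E\xrightarrow{l}E_1$ implies there is $E_2$ with $E'\overset{l}{\Rightarrow}E_2$ and $W\,E_1\,E_2$, and $E'\xrightarrow{l}E_2$ implies there is $E_1$ with $E\overset{l}{\Rightarrow}E_1$ and $W\,E_1\,E_2$; and $E\xrightarrow{\tau}E_1$ implies there is $E_2$ with $E'\overset{\epsilon}{\Rightarrow}E_2$ and $W\,E_1\,E_2$, and $E'\xrightarrow{\tau}E_2$ implies there is $E_1$ with $E\overset{\epsilon}{\Rightarrow}E_1$ and $W\,E_1\,E_2$. Weak equivalence: $E\approx E'$ iff $W\,E\,E'$ for some weak bisimulation $W$. Observation congruence: $E\approx^c E'$ iff for every action $u$ (including $\tau$): for every $E_1$ with $E\xrightarrow{u}E_1$ there is $E_2$ with $E'\overset{u}{\Rightarrow}E_2$ and $E_1\approx E_2$; and for every $E_2$ with $E'\xrightarrow{u}E_2$ there is $E_1$ with $E\overset{u}{\Rightarrow}E_1$ and $E_1\approx E_2$. -}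

module Defs where

open import Level using (Level; _⊔_; suc)
open import Data.Product using (_×_; ∃-syntax)
open import Relation.Binary.Construct.Closure.ReflexiveTransitive using (Star)
open import Relation.Binary.Core using (Rel)
open import Relation.Binary.Definitions using (DecidableEquality)
open import Relation.Binary.PropositionalEquality using (_≡_)
open import Relation.Nullary.Decidable using (yes; no)
open import Relation.Unary using (Pred; _∉_)

-- Substitution compares process variables; classically _≟_ always exists.
module CCS {a b : Level} (α : Set a) (β : Set b) (_≟_ : DecidableEquality α) where

  infixr 8 _·_
  infixl 7 _∥_
  infixl 6 _⊕_
  infix  9 _[_/_]
  infix  4 _─[_]→_ _⇒ε_ _═[_]⇒_ _≈_ _≈ᶜ_

  data Label : Set b where
    name coname : β → Label

  compl : Label → Label
  compl (name x)   = coname x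
  compl (coname x) = name x

  data Action : Set b where
    τ   : Action
    lab : Label → Action

  record Relabelling : Set b where
    field
      fun       : Label → Label
      fun-compl : ∀ l → fun (compl l) ≡ compl (fun l)

  relabel : Relabelling → Action → Action
  relabel f τ       = τ
  relabel f (lab l) = lab (Relabelling.fun f l)

  ℓ : Level
  ℓ = a ⊔ suc b

  data Process : Set ℓ where
    nil   : Process
    var   : α → Process
    _·_   : Action → Process → Process
    _⊕_   : Process → Process → Process
    _∥_   : Process → Process → Process
    ν     : Pred Label b → Process → Process
    relab : Process → Relabelling → Process
    rec   : α → Process → Process

  -- E [ F / X ] replaces the free occurrences of X in E by F. It is not
  -- capture-avoiding: free variables of F may be captured by binders of E.
  _[_/_] : Process → Process → α → Process
  nil [ F / X ] = nil
  var Y [ F / X ] with X ≟ Y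
  ... | yes _ = F
  ... | no  _ = var Y
  (u · E) [ F / X ] = u · (E [ F / X ])
  (E ⊕ E′) [ F / X ] = (E [ F / X ]) ⊕ (E′ [ F / X ])
  (E ∥ E′) [ F / X ] = (E [ F / X ]) ∥ (E′ [ F / X ])
  ν L E [ F / X ] = ν L (E [ F / X ])
  relab E f [ F / X ] = relab (E [ F / X ]) f
  rec Y E [ F / X ] with X ≟ Y
  ... | yes _ = rec Y E
  ... | no  _ = rec Y (E [ F / X ])

  data _─[_]→_ : Process → Action → Process → Set ℓ where
    prefix : ∀ {u E} → u · E ─[ u ]→ E
    sumˡ   : ∀ {u E E₁ E′} → E ─[ u ]→ E₁ → E ⊕ E′ ─[ u ]→ E₁
    sumʳ   : ∀ {u E E₁ E′} → E ─[ u ]→ E₁ → E′ ⊕ E ─[ u ]→ E₁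
    parˡ   : ∀ {u E E₁ E′} → E ─[ u ]→ E₁ → E ∥ E′ ─[ u ]→ E₁ ∥ E′
    parʳ   : ∀ {u E E₁ E′} → E ─[ u ]→ E₁ → E′ ∥ E ─[ u ]→ E′ ∥ E₁
    sync   : ∀ {l E E₁ E′ E₂} →
             E ─[ lab l ]→ E₁ → E′ ─[ lab (compl l) ]→ E₂ →
             E ∥ E′ ─[ τ ]→ E₁ ∥ E₂
    res-τ  : ∀ {L E E₁} → E ─[ τ ]→ E₁ → ν L E ─[ τ ]→ ν L E₁
    res-l  : ∀ {L l E E₁} → E ─[ lab l ]→ E₁ → l ∉ L → compl l ∉ L →
             ν L E ─[ lab l ]→ ν L E₁
    rel    : ∀ {u f E E₁} → E ─[ u ]→ E₁ →
             relab E f ─[ relabel f u ]→ relab E₁ f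
    unfold : ∀ {u X E E₁} → E [ rec X E / X ] ─[ u ]→ E₁ → rec X E ─[ u ]→ E₁

  _⇒ε_ : Rel Process ℓ
  _⇒ε_ = Star (λ E E′ → E ─[ τ ]→ E′)

  _═[_]⇒_ : Process → Action → Process → Set ℓ
  E ═[ u ]⇒ E′ = ∃[ E₁ ] ∃[ E₂ ] (E ⇒ε E₁ × E₁ ─[ u ]→ E₂ × E₂ ⇒ε E′)

  record WeakBisimulation (W : Rel Process ℓ) : Set ℓ where
    field
      labelˡ : ∀ {E E′} → W E E′ → ∀ l {E₁} → E ─[ lab l ]→ E₁ →
               ∃[ E₂ ] (E′ ═[ lab l ]⇒ E₂ × W E₁ E₂)
      labelʳ : ∀ {E E′} → W E E′ → ∀ l {E₂} → E′ ─[ lab l ]→ E₂ →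
               ∃[ E₁ ] (E ═[ lab l ]⇒ E₁ × W E₁ E₂)
      tauˡ   : ∀ {E E′} → W E E′ → ∀ {E₁} → E ─[ τ ]→ E₁ →
               ∃[ E₂ ] (E′ ⇒ε E₂ × W E₁ E₂)
      tauʳ   : ∀ {E E′} → W E E′ → ∀ {E₂} → E′ ─[ τ ]→ E₂ →
               ∃[ E₁ ] (E ⇒ε E₁ × W E₁ E₂)

  _≈_ : Rel Process (suc ℓ)
  E ≈ E′ = ∃[ W ] (WeakBisimulation W × W E E′)

  record _≈ᶜ_ (E E′ : Process) : Set (suc ℓ) where
    field
      forth : ∀ u {E₁} → E ─[ u ]→ E₁ → ∃[ E₂ ] (E′ ═[ u ]⇒ E₂ × E₁ ≈ E₂)
      back  : ∀ u {E₂} → E′ ─[ u ]→ E₂ → ∃[ E₁ ] (E ═[ u ]⇒ E₁ × E₁ ≈ E₂)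

{-# OPTIONS --safe #-}

-- If p ≈ q and some τ-derivative of p is weakly equivalent to q, then p ≈ᶜ τ · q;
-- symmetrically, if some τ-derivative of q is weakly equivalent to p, then
-- τ · p ≈ᶜ q.  If neither happens, no τ-move of p or q can be answered by the
-- other side standing still, so p ≈ᶜ q.  Conversely, τ · q differs from q only by an
-- initial τ, which weak matching ignores.
module Submission where

open import Defs
open import Level using (Level; Lift; lift; _⊔_; suc)
open import Axiom.ExcludedMiddle using (ExcludedMiddle)
open import Data.Empty using (⊥-elim)
open import Data.Product using (_×_; _,_; ∃-syntax; swap)
open import Data.Sum using (_⊎_; inj₁; inj₂; [_,_])
open import Function.Base using (flip)
open import Function.Bundles using (_⇔_; mk⇔)
open import Relation.Binary.Construct.Closure.ReflexiveTransitive using (ε; _◅_; _◅◅_)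
open import Relation.Binary.Core using (Rel)
open import Relation.Binary.Definitions using (DecidableEquality)
open import Relation.Nullary.Decidable using (yes; no; True; toWitness; fromWitness)
open import Relation.Nullary.Negation using (¬_)

module WeakEquivalence {a b : Level} (α : Set a) (β : Set b) (_≟_ : DecidableEquality α) where

  open CCS α β _≟_

  infix 4 _⇛[_]_

  -- The answers that a weak bisimulation permits, given uniformly in the action; unlike `═[ τ ]⇒`,
  -- the case `τ` allows standing still.
  _⇛[_]_ : Process → Action → Process → Set ℓ
  E ⇛[ τ ]     E′ = E ⇒ε E′
  E ⇛[ lab l ] E′ = E ═[ lab l ]⇒ E′

  -- Only the first move is one-sided: the derivatives are compared by the symmetric `≈`, so this is
  -- not the simulation preorder.
  _≲_ : Rel Process (suc ℓ)
  E ≲ E′ = ∀ u {E₁} → E ─[ u ]→ E₁ → ∃[ E₂ ] (E′ ⇛[ u ] E₂ × E₁ ≈ E₂)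

  _≲ᶜ_ : Rel Process (suc ℓ)
  E ≲ᶜ E′ = ∀ u {E₁} → E ─[ u ]→ E₁ → ∃[ E₂ ] (E′ ═[ u ]⇒ E₂ × E₁ ≈ E₂)

  ═⇒-⇛ : ∀ u {E E′} → E ═[ u ]⇒ E′ → E ⇛[ u ] E′
  ═⇒-⇛ τ       (_ , _ , s , t , s′) = s ◅◅ t ◅ s′
  ═⇒-⇛ (lab _) w                    = w

  ⇒ε-⇛ : ∀ u {E E₁ E′} → E ⇒ε E₁ → E₁ ⇛[ u ] E′ → E ⇛[ u ] E′
  ⇒ε-⇛ τ       r s                    = r ◅◅ s
  ⇒ε-⇛ (lab _) r (_ , _ , s , t , s′) = _ , _ , r ◅◅ s , t , s′

  τ·-⇛ : ∀ u {E E′} → E ⇛[ u ] E′ → τ · E ═[ u ]⇒ E′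
  τ·-⇛ τ       s                    = _ , _ , ε , prefix , s
  τ·-⇛ (lab _) (_ , _ , s , t , s′) = _ , _ , prefix ◅ s , t , s′

  τ·-⇛⁻¹ : ∀ u {E E′} → τ · E ═[ u ]⇒ E′ → E ⇛[ u ] E′
  τ·-⇛⁻¹ τ       (_ , _ , ε          , prefix , s′) = s′
  τ·-⇛⁻¹ τ       (_ , _ , prefix ◅ s , t      , s′) = s ◅◅ t ◅ s′
  τ·-⇛⁻¹ (lab _) (_ , _ , prefix ◅ s , t      , s′) = _ , _ , s , t , s′

  ≈-sym : ∀ {E E′} → E ≈ E′ → E′ ≈ E
  ≈-sym (W , bisim , w) = flip W , record
    { labelˡ = labelʳ ; labelʳ = labelˡ ; tauˡ = tauʳ ; tauʳ = tauˡ } , w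
    where open WeakBisimulation bisim

  ≈ᶜ-sym : ∀ {E E′} → E ≈ᶜ E′ → E′ ≈ᶜ E
  ≈ᶜ-sym E≈ᶜE′ = record
    { forth = λ u t → let _ , w , e = back  u t in _ , w , ≈-sym e
    ; back  = λ u t → let _ , w , e = forth u t in _ , w , ≈-sym e }
    where open _≈ᶜ_ E≈ᶜE′

  ≲ᶜ-antisym : ∀ {E E′} → E ≲ᶜ E′ → E′ ≲ᶜ E → E ≈ᶜ E′
  ≲ᶜ-antisym E≲E′ E′≲E = record
    { forth = E≲E′
    ; back  = λ u t → let _ , w , e = E′≲E u t in _ , w , ≈-sym e }

  ≲ᶜ⇒≲ : ∀ {E E′} → E ≲ᶜ E′ → E ≲ E′
  ≲ᶜ⇒≲ E≲E′ u t = let _ , w , e = E≲E′ u t in _ , ═⇒-⇛ u w , e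

  ≈⇒≲ : ∀ {E E′} → E ≈ E′ → E ≲ E′
  ≈⇒≲ (W , bisim , w) τ t =
    let _ , s , w₁ = WeakBisimulation.tauˡ bisim w t in _ , s , W , bisim , w₁
  ≈⇒≲ (W , bisim , w) (lab l) t =
    let _ , s , w₁ = WeakBisimulation.labelˡ bisim w l t in _ , s , W , bisim , w₁

  τ-derivative⇒≈ᶜτ· : ∀ {p p′ q} → p ≈ q → p ─[ τ ]→ p′ → p′ ≈ q → p ≈ᶜ τ · q
  τ-derivative⇒≈ᶜτ· p≈q t p′≈q = ≲ᶜ-antisym
    (λ u s → let _ , w , e = ≈⇒≲ p≈q u s in _ , τ·-⇛ u w , e)
    -- The only move of `τ · q` leads to `q`; the given transition `t` of `p` answers it.
    (λ { _ prefix → _ , (_ , _ , ε , t , ε) , ≈-sym p′≈q })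

  ≲⇒≲ᶜ : ∀ {p q} → ¬ (∃[ p′ ] (p ─[ τ ]→ p′ × p′ ≈ q)) → p ≲ q → p ≲ᶜ q
  ≲⇒≲ᶜ ¬still p≲q (lab l) t = p≲q (lab l) t
  ≲⇒≲ᶜ ¬still p≲q τ t with p≲q τ t
  -- The empty answer would make the `τ`-derivative of `p` weakly equivalent to `q` itself.
  ... | _ , ε     , e = ⊥-elim (¬still (_ , t , e))
  ... | _ , r ◅ s , e = _ , (_ , _ , ε , r , s) , e

  module Classical (em : ExcludedMiddle (suc ℓ)) where

    -- ≲ and ≈ live in Set (suc ℓ), whereas a weak bisimulation must be valued in
    -- Set ℓ: excluded middle resizes the relation via its truth value.
    ≲-antisym : ∀ {E E′} → E ≲ E′ → E′ ≲ E → E ≈ E′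
    ≲-antisym E≲E′ E′≲E = W , bisim , resize (E≲E′ , E′≲E)
      where
      W : Rel Process ℓ
      W F F′ = Lift ℓ (True (em {F ≲ F′ × F′ ≲ F}))

      resize : ∀ {F F′} → F ≲ F′ × F′ ≲ F → W F F′
      resize w = lift (fromWitness w)

      unresize : ∀ {F F′} → W F F′ → F ≲ F′ × F′ ≲ F
      unresize (lift w) = toWitness w

      W-sym : ∀ {F F′} → W F F′ → W F′ F
      W-sym w = resize (swap (unresize w))

      step : ∀ {F F′} → W F F′ → ∀ u {F₁} → F ─[ u ]→ F₁ →
             ∃[ F₂ ] (F′ ⇛[ u ] F₂ × W F₁ F₂)
      step w u t =
        let F≲F′ , _ = unresize w
            _ , s , e = F≲F′ u t
        -- The derivatives are already related by `≈`, which lies inside `W`.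
        in _ , s , resize (≈⇒≲ e , ≈⇒≲ (≈-sym e))

      step-sym : ∀ {F F′} → W F F′ → ∀ u {F₂} → F′ ─[ u ]→ F₂ →
                 ∃[ F₁ ] (F ⇛[ u ] F₁ × W F₁ F₂)
      step-sym w u t = let _ , s , w₁ = step (W-sym w) u t in _ , s , W-sym w₁

      bisim : WeakBisimulation W
      bisim = record
        { labelˡ = λ w l → step w (lab l)
        ; labelʳ = λ w l → step-sym w (lab l)
        ; tauˡ   = λ w → step w τ
        ; tauʳ   = λ w → step-sym w τ }

    ≈ᶜ⇒≈ : ∀ {p q} → p ≈ᶜ q → p ≈ q
    ≈ᶜ⇒≈ p≈ᶜq = ≲-antisym (≲ᶜ⇒≲ (_≈ᶜ_.forth p≈ᶜq)) (≲ᶜ⇒≲ (_≈ᶜ_.forth (≈ᶜ-sym p≈ᶜq)))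

    ≈ᶜτ·⇒≈ : ∀ {p q} → p ≈ᶜ τ · q → p ≈ q
    ≈ᶜτ·⇒≈ p≈ᶜτq = ≲-antisym
      (λ u t → let _ , w , e = forth u t in _ , τ·-⇛⁻¹ u w , e)
      -- p ⇒ε p′ ≈ q answers the move τ · q ─[ τ ]→ q, and p′ then matches the moves of q.
      (λ u t → let _ , r , p′≈q = back τ prefix
                   _ , s , e    = ≈⇒≲ (≈-sym p′≈q) u t
               in _ , ⇒ε-⇛ u (═⇒-⇛ τ r) s , e)
      where open _≈ᶜ_ p≈ᶜτq

    ≈⇒≈ᶜ-up-to-τ : ∀ {p q} → p ≈ q → p ≈ᶜ q ⊎ p ≈ᶜ τ · q ⊎ τ · p ≈ᶜ q
    ≈⇒≈ᶜ-up-to-τ {p} {q} p≈q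
      with em {∃[ p′ ] (p ─[ τ ]→ p′ × p′ ≈ q)} | em {∃[ q′ ] (q ─[ τ ]→ q′ × q′ ≈ p)}
    ... | yes (_ , t , e) | _               = inj₂ (inj₁ (τ-derivative⇒≈ᶜτ· p≈q t e))
    ... | no _            | yes (_ , t , e) =
      inj₂ (inj₂ (≈ᶜ-sym (τ-derivative⇒≈ᶜτ· (≈-sym p≈q) t e)))
    ... | no ¬p           | no ¬q           =
      inj₁ (≲ᶜ-antisym (≲⇒≲ᶜ ¬p (≈⇒≲ p≈q)) (≲⇒≲ᶜ ¬q (≈⇒≲ (≈-sym p≈q))))

theorem9 : ∀ {a b : Level} → ExcludedMiddle (suc (a ⊔ suc b)) →
    (α : Set a) (β : Set b) (_≟_ : DecidableEquality α) → α → β →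
    let open CCS α β _≟_ in
    (p q : Process) → p ≈ q ⇔ (p ≈ᶜ q ⊎ p ≈ᶜ τ · q ⊎ τ · p ≈ᶜ q)
theorem9 em α β _≟_ _ _ p q =
  -- The third alternative is the second with `p` and `q` exchanged.
  mk⇔ ≈⇒≈ᶜ-up-to-τ [ ≈ᶜ⇒≈ , [ ≈ᶜτ·⇒≈ , (λ e → ≈-sym (≈ᶜτ·⇒≈ (≈ᶜ-sym e))) ] ]
  where
  open WeakEquivalence α β _≟_
  open Classical em
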